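{- For any positive integer $n$ and any integer $a$, the set $$\mathcal{M}_{n,a}:=\{w\in\mathcal{M}_n\mid l(w)\equiv a\pmod{n+1}\}$$ is a perfect code, i.e. (1) for any different $w,w'\in\mathcal{M}_{n,a}$, $\mathrm{dS}(w)\cap\mathrm{dS}(w')=\emptyset$, and (2) $\bigcup_{w\in\mathcal{M}_{n,a}}\mathrm{dS}(w)=\mathcal{M}_{n-1}$.
   Context: For $m\ge1$ let $\epsilon_1,\dots,\epsilon_m$ be the standard basis of $\mathbb{R}^m$, $\alpha_1:=\epsilon_1$, $\alpha_i:=\epsilon_i-\epsilon_{i-1}$ for $2\le i\le m$, $s_i$ the orthogonal reflection associated with $\alpha_i$, and $W(B_m)$ the group generated by $s_1,\dots,s_m$ ($W(B_0)$ is trivial). $W(B_m)$ is regarded as the subgroup of $W(B_{m+1})$ generated by $s_1,\dots,s_m$. The length $l(w)$ is the least number of generators $s_i$ in an expression of $w$. For $J=\{j_1<\dots<j_t\}\subseteq\{1,\dots,m\}$ let $w_J:=w_{j_1}w_{j_2}\cdots w_{j_t}$ (composition of maps, rightmost applied first), where $w_j:=s_js_{j-1}\cdots s_1$ and $w_\emptyset=\mathrm{id}$; let $\mathcal{M}_m:=\{w_J\mid J\subseteq\{1,\dots,m\}\}$, so $\mathcal{M}_m\subset\mathcal{M}_{m+1}$. Let $W(A_{m-1})$ be the subgroup of $W(B_m)$ generated by $s_2,\dots,s_m$. $\mathcal{M}_m$ is the set of minimal-length representatives of the cosets $[w]=wW(A_{m-1})$, and $W(B_m)$ acts on $\mathcal{M}_m$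 by $v\cdot w:=$ the minimal-length representative of $[vw]$. For $0\le j\le 2m+1$ define $\mathcal{I}^{(m)}_j\in W(B_{m+1})$: $\mathcal{I}^{(m)}_0:=\mathrm{id}$; $\mathcal{I}^{(m)}_j:=s_{m+2-j}\cdots s_ms_{m+1}$ for $1\le j\le m$; $\mathcal{I}^{(m)}_j:=s_{j-m}\cdots s_2s_1\mathcal{I}^{(m)}_m$ for $m+1\le j\le2m+1$. For $y\in\mathcal{M}_m$ the insertion sphere is $\mathrm{iS}(y):=\{\mathcal{I}^{(m)}_j\cdot y\mid 0\le j\le 2m+1\}\subset\mathcal{M}_{m+1}$. For $w\in\mathcal{M}_n$ the deletion sphere is $\mathrm{dS}(w):=\{y\in\mathcal{M}_{n-1}\mid w\in\mathrm{iS}(y)\}$. -}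

module Defs where

open import Data.Bool.Base using (if_then_else_)
open import Data.Fin.Base using (Fin; zero; suc; toℕ; inject₁)
open import Data.Fin.Subset using (Subset)
open import Data.Fin.Subset.Properties using (_∈?_)
open import Data.Integer.Base as ℤ using (ℤ; +_)
import Data.Integer.Divisibility as ℤ
open import Data.List.Base as List
  using (List; []; _∷_; _++_; length; filter; reverse; concatMap; allFin)
open import Data.List.Relation.Unary.All using (All)
open import Data.Nat.Base as ℕ using (ℕ; zero; suc; _≤_; _∸_)
import Data.Nat.Properties as ℕ
open import Data.Product.Base using (_×_; _,_; ∃; ∃-syntax)
open import Data.Rational.Base as ℚ using (ℚ; 0ℚ; 1ℚ; NonZero; _÷_)
import Data.Rational.Properties as ℚ
open import Data.Vec.Base as Vec
  using (Vec; []; _∷_; _[_]≔_; replicate; zipWith; foldr′; init; last; _∷ʳ_)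
open import Function.Base using (_∘_; id)
open import Relation.Binary.PropositionalEquality
  using (_≡_; refl; sym; trans; cong; subst; _≗_)
open import Relation.Nullary.Decidable.Core using (does)
open import Relation.Nullary.Negation.Core using (¬_)
open import Relation.Unary using (Pred; _∈_; _∩_; _≐_; Empty)
open import Level using (0ℓ)

private variable
  m : ℕ

-- ℚ^m replaces ℝ^m: the simple roots are rational, so every reflection
-- preserves ℚ^m and is determined by its restriction to it.
V : ℕ → Set
V m = Vec ℚ m

infixl 6 _⊖_
infixr 7 _·_

_⊖_ : V m → V m → V m
_⊖_ = zipWith ℚ._-_

_·_ : ℚ → V m → V m
c · v = Vec.map (c ℚ.*_) v

⟨_,_⟩ : V m → V m → ℚ
⟨ u , v ⟩ = foldr′ ℚ._+_ 0ℚ (zipWith ℚ._*_ u v)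

2ℚ : ℚ
2ℚ = 1ℚ ℚ.+ 1ℚ

reflection : (α : V m) → .{{_ : NonZero ⟨ α , α ⟩}} → V m → V m
reflection α v = v ⊖ (2ℚ ℚ.* ⟨ v , α ⟩ ÷ ⟨ α , α ⟩) · α

ε : Fin m → V m
ε i = replicate _ 0ℚ [ i ]≔ 1ℚ

-- Indices in {1,…,m} are represented by Fin m; `zero` stands for 1.
index : Fin m → ℕ
index i = suc (toℕ i)

α : Fin m → V m
α zero    = ε zero
α (suc i) = ε (suc i) ⊖ ε (inject₁ i)

private
  norm-0 : ∀ m → ⟨ replicate m 0ℚ , replicate m 0ℚ ⟩ ≡ 0ℚ
  norm-0 zero    = refl
  norm-0 (suc m) = trans (ℚ.+-identityˡ _) (norm-0 m)

  norm-0⊖0 : ∀ m → let z = replicate m 0ℚ ⊖ replicate m 0ℚ in ⟨ z , z ⟩ ≡ 0ℚ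
  norm-0⊖0 zero    = refl
  norm-0⊖0 (suc m) = trans (ℚ.+-identityˡ _) (norm-0⊖0 m)

  norm-αsuc : ∀ {m} (i : Fin m) → ⟨ α (suc i) , α (suc i) ⟩ ≡ 2ℚ
  norm-αsuc {suc m} zero    = cong (λ q → 1ℚ ℚ.+ (1ℚ ℚ.+ q)) (norm-0⊖0 m)
  norm-αsuc {suc m} (suc i) = trans (ℚ.+-identityˡ _) (norm-αsuc i)

α-nonZero : (i : Fin m) → NonZero ⟨ α i , α i ⟩
α-nonZero {suc m} zero    = subst NonZero (cong (1ℚ ℚ.+_) (sym (norm-0 m))) _
α-nonZero {suc m} (suc i) = subst NonZero (sym (norm-αsuc i)) _

s : Fin m → V m → V m
s i = reflection (α i) {{α-nonZero i}}

-- The word i₁ ∷ i₂ ∷ … denotes s_{i₁} ∘ s_{i₂} ∘ ⋯.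
⟦_⟧ : List (Fin m) → V m → V m
⟦ []     ⟧ = id
⟦ i ∷ is ⟧ = s i ∘ ⟦ is ⟧

-- Maps are compared by pointwise equality _≗_ throughout. As the s_i are
-- involutions, W(B_m) consists of the maps ⟦ is ⟧, and its subgroup W(A_{m-1}),
-- generated by s₂,…,s_m, of those with all letters in {2,…,m}.
WA : (m : ℕ) → Pred (V m → V m) 0ℓ
WA m f = ∃[ is ] All (λ i → 2 ≤ index i) is × f ≗ ⟦ is ⟧

-- W(B_m) → W(B_{m+1}), s_i ↦ s_i: act on the first m coordinates, fix ε_{m+1}.
extend : (V m → V m) → V (suc m) → V (suc m)
extend f v = f (init v) ∷ʳ last v

-- HasLength w k means l(w) = k.
HasLength : (V m → V m) → ℕ → Set
HasLength w k = (∃[ is ] w ≗ ⟦ is ⟧ × length is ≡ k)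
              × (∀ is → w ≗ ⟦ is ⟧ → k ≤ length is)

-- The coset [w] = w W(A_{m-1}).
[_] : (V m → V m) → Pred (V m → V m) 0ℓ
[ w ] x = ∃[ u ] u ∈ WA _ × x ≗ w ∘ u

MinRep : (V m → V m) → Pred (V m → V m) 0ℓ
MinRep w x = x ∈ [ w ]
           × ∃[ k ] HasLength x k × (∀ z l → z ∈ [ w ] → HasLength z l → k ≤ l)

-- s_a s_{a+1} ⋯ s_m and s_b s_{b-1} ⋯ s_1, empty for a > m and b = 0.
ascending descending : ∀ m → ℕ → List (Fin m)
ascending  m a = filter (λ i → a ℕ.≤? index i) (allFin m)
descending m b = reverse (filter (λ i → index i ℕ.≤? b) (allFin m))

w[_] : Subset m → List (Fin m)
w[_] {m} J = concatMap (descending m ∘ index) (filter (_∈? J) (allFin m))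

𝓜 : (m : ℕ) → Pred (V m → V m) 0ℓ
𝓜 m x = ∃[ J ] x ≗ ⟦ w[ J ] ⟧

-- v ∙ w ↦ x means x = v·w for the action of W(B_m) on 𝓜 m.
_∙_↦_ : (v w x : V m → V m) → Set
v ∙ w ↦ x = MinRep (v ∘ w) x

-- For 1 ≤ j ≤ m: s_{m+2-j} ⋯ s_{m+1}. For j > m: s_{j-m} ⋯ s_1 followed by the
-- word for j = m; there `ascending (suc m) 2` is that word, also when m = 0,
-- where it is empty.
𝓘 : (m j : ℕ) → List (Fin (suc m))
𝓘 m zero        = []
𝓘 m j@(suc _)   =
  if does (j ℕ.≤? m)
  then ascending (suc m) (m ℕ.+ 2 ∸ j)
  else descending (suc m) (j ∸ m) ++ ascending (suc m) 2

iS : (V m → V m) → Pred (V (suc m) → V (suc m)) 0ℓ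
iS {m} y x = ∃[ j ] j ≤ 2 ℕ.* m ℕ.+ 1 × ⟦ 𝓘 m j ⟧ ∙ extend y ↦ x

dS : (V (suc m) → V (suc m)) → Pred (V m → V m) 0ℓ
dS {m} w y = y ∈ 𝓜 m × w ∈ iS y

_≡_[mod_] : ℤ → ℤ → ℕ → Set
x ≡ a [mod k ] = + k ℤ.∣ x ℤ.- a

𝓜ₐ : (n : ℕ) → ℤ → Pred (V n → V n) 0ℓ
𝓜ₐ n a w = w ∈ 𝓜 n × ∃[ k ] HasLength w k × (+ k) ≡ a [mod suc n ]

IsPerfectCode : Pred (V (suc m) → V (suc m)) 0ℓ → Set
IsPerfectCode {m} C =
    (∀ w w′ → w ∈ C → w′ ∈ C → ¬ (w ≗ w′) → Empty (dS w ∩ dS w′))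
  × (λ y → ∃[ w ] w ∈ C × y ∈ dS w) ≐ 𝓜 m

{-# OPTIONS --safe #-}

-- Each s_i negates the first coordinate or swaps two adjacent ones, so a coset
-- w W(A_{m-1}) is determined by the sign vector w(1,…,1); let J be the set of
-- its negative positions. A generator changes the weight Σ_{j∈J} j by at most
-- one, and w_J attains it, so this weight is the length of the minimal
-- representative w_J. The element 𝓘_j moves the last coordinate to an arbitrary
-- position and possibly negates it; thus iS(y) corresponds to the words obtained
-- by inserting one bit, and 𝓜_{n,a} is the Varshamov–Tenengolts code. Inserting
-- a bit in a word of length m raises the weight by an offset in {0,…,m+1}; every
-- such offset occurs, and it determines the resulting word. So exactly one
-- inserted word has weight congruent to a modulo m + 2.
module Submission where

open import Algebra.Definitions using (Involutive)
open import Algebra.Properties.Group using (⁻¹-involutive)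
open import Data.Bool.Base using (Bool; true; false; not; if_then_else_)
open import Data.Bool.Properties using (not-involutive)
open import Data.Fin.Base using (Fin; zero; suc; inject₁; toℕ; fromℕ<)
import Data.Fin.Properties as Fin
open import Data.Fin.Subset using (Subset)
open import Data.Fin.Subset.Properties using (_∈?_)
open import Data.Integer.Base as ℤ using (ℤ; +_)
import Data.Integer.DivMod as ℤ
import Data.Integer.Divisibility.Signed as ℤ
import Data.Integer.Properties as ℤ
import Data.Integer.Tactic.RingSolver as ℤ
open import Data.List.Base as List
  using (List; []; _∷_; _++_; reverse; length; allFin; concatMap)
import Data.List.Properties as List
open import Data.List.Relation.Unary.All as All using (All; []; _∷_)
open import Data.List.Relation.Unary.All.Properties using (all-filter)
open import Data.Nat.Base as ℕ
  using (ℕ; zero; suc; _≤_; _<_; _+_; _∸_; s≤s; z≤n; s≤s⁻¹)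
import Data.Nat.Divisibility as ℕ
open import Data.Nat.ListAction using (sum)
import Data.Nat.Properties as ℕ
import Data.Nat.Tactic.RingSolver as ℕ
open import Algebra.Properties.CommutativeSemigroup ℕ.+-commutativeSemigroup
  using (x∙yz≈y∙xz)
open import Data.Product.Base using (_×_; _,_; ∃-syntax; proj₂)
open import Data.Rational.Base as ℚ using (ℚ; -_; 0ℚ; 1ℚ; NonZero; _÷_)
import Data.Rational.Properties as ℚ
open import Data.Rational.Solver using (module +-*-Solver)
open import Data.Vec.Base as Vec using (Vec; []; _∷_; replicate; zipWith; _∷ʳ_; insertAt)
import Data.Vec.Properties as Vec
open import Function.Base using (_∘_; id)
open import Level using (0ℓ)
open import Relation.Binary.PropositionalEquality hiding ([_])
open import Relation.Nullary.Decidable using (does; yes; no; dec-true; dec-false)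
open import Relation.Nullary.Negation.Core using (¬_; contradiction)
open import Relation.Unary using (Pred; Decidable; _∈_; Empty; _∩_)
open import Defs

open +-*-Solver using (solve; con; _:=_; _:+_; _:*_; _:-_; :-_)

private variable
  m n : ℕ
  A B : Set
  neg : A → A

-- Generators as maps of coordinates

swap : Fin m → Vec A (suc m) → Vec A (suc m)
swap zero    (x ∷ y ∷ v) = y ∷ x ∷ v
swap (suc i) (x ∷ v)     = x ∷ swap i v

move : (A → A) → Fin m → Vec A m → Vec A m
move neg zero    (x ∷ v) = neg x ∷ v
move neg (suc i) v       = swap i v

-- With neg = -_ this is the action of W(B_m) on ℚ^m; with neg = not, on the sign
-- vectors, where `true` stands for -1.
act : (A → A) → List (Fin m) → Vec A m → Vec A m
act neg is v = List.foldr (move neg) v is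

⟨,0⟩ : (v : V m) → ⟨ v , replicate m 0ℚ ⟩ ≡ 0ℚ
⟨,0⟩ []      = refl
⟨,0⟩ (x ∷ v) = cong₂ ℚ._+_ (ℚ.*-zeroʳ x) (⟨,0⟩ v)

0⊖0 : replicate m 0ℚ ⊖ replicate m 0ℚ ≡ replicate m 0ℚ
0⊖0 = Vec.zipWith-replicate ℚ._-_ 0ℚ 0ℚ

⊖·0 : ∀ c (v : V m) → v ⊖ c · replicate m 0ℚ ≡ v
⊖·0 c []      = refl
⊖·0 c (x ∷ v) = cong₂ _∷_ (solve 2 (λ c x → x :- c :* con 0ℚ := x) refl c x) (⊖·0 c v)

norm-α-zero : ∀ m → ⟨ α {suc m} zero , α zero ⟩ ≡ 1ℚ
norm-α-zero m = cong (1ℚ ℚ.+_) (⟨,0⟩ (replicate m 0ℚ))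

norm-α-suc : (i : Fin m) → ⟨ α (suc i) , α (suc i) ⟩ ≡ 2ℚ
norm-α-suc {suc m} zero rewrite 0⊖0 {m} | ⟨,0⟩ (replicate m 0ℚ) = refl
norm-α-suc (suc i) = trans (ℚ.+-identityˡ _) (norm-α-suc i)

reflection-norm-1 : (α v : V m) .{{_ : NonZero ⟨ α , α ⟩}} →
                    ⟨ α , α ⟩ ≡ 1ℚ → reflection α v ≡ v ⊖ (2ℚ ℚ.* ⟨ v , α ⟩) · α
reflection-norm-1 α v norm = cong (λ c → v ⊖ c · α) (÷1 ⟨ α , α ⟩ norm)
  where
  p = 2ℚ ℚ.* ⟨ v , α ⟩
  -- The nonzero proof of the divisor depends on ⟨α,α⟩, so the divisor is generalised to `q` before
  -- its value is substituted.
  ÷1 : ∀ q .{{_ : NonZero q}} → q ≡ 1ℚ → p ÷ q ≡ p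
  ÷1 _ refl = ℚ.*-identityʳ p

reflection-norm-2 : (α v : V m) .{{_ : NonZero ⟨ α , α ⟩}} →
                    ⟨ α , α ⟩ ≡ 2ℚ → reflection α v ≡ v ⊖ ⟨ v , α ⟩ · α
reflection-norm-2 α v norm = cong (λ c → v ⊖ c · α) (2*÷2 ⟨ α , α ⟩ norm)
  where
  p = ⟨ v , α ⟩
  2*÷2 : ∀ q .{{_ : NonZero q}} → q ≡ 2ℚ → 2ℚ ℚ.* p ÷ q ≡ p
  2*÷2 _ refl = solve 1 (λ p → con 2ℚ :* p :* con (ℚ.1/ 2ℚ) := p) refl p

⊖α-zero : (v : V (suc m)) → v ⊖ (2ℚ ℚ.* ⟨ v , α zero ⟩) · α zero ≡ move -_ zero v
⊖α-zero (x ∷ v) rewrite ⟨,0⟩ v = cong₂ _∷_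
  (solve 1 (λ x → x :- con 2ℚ :* (x :* con 1ℚ :+ con 0ℚ) :* con 1ℚ := :- x) refl x)
  (⊖·0 (2ℚ ℚ.* (x ℚ.* 1ℚ ℚ.+ 0ℚ)) v)

-- The root (-1,1,0,...) has inner product y - x with (x,y,...), and subtracting that multiple of it
-- exchanges x and y. A leading 0 in the root leaves the first coordinate alone.
⊖α-suc : (i : Fin m) (v : V (suc m)) → v ⊖ ⟨ v , α (suc i) ⟩ · α (suc i) ≡ swap i v
⊖α-suc {suc m} zero (x ∷ y ∷ v)
  rewrite 0⊖0 {m} | ⟨,0⟩ v =
  cong₂ _∷_ (solve 2 (λ x y → x :- c x y :* con (- 1ℚ) := y) refl x y)
  (cong₂ _∷_ (solve 2 (λ x y → y :- c x y :* con 1ℚ := x) refl x y)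
             (⊖·0 (x ℚ.* ℚ.- 1ℚ ℚ.+ (y ℚ.* 1ℚ ℚ.+ 0ℚ)) v))
  where c = λ x y → x :* con (- 1ℚ) :+ (y :* con 1ℚ :+ con 0ℚ)
⊖α-suc (suc i) (x ∷ v)
  rewrite ℚ.*-zeroʳ x | ℚ.+-identityˡ ⟨ v , α (suc i) ⟩ =
  cong₂ _∷_ (solve 2 (λ c x → x :- c :* con 0ℚ := x) refl ⟨ v , α (suc i) ⟩ x) (⊖α-suc i v)

s≗move : (i : Fin m) → s i ≗ move -_ i
s≗move {suc m} zero v = trans
  (reflection-norm-1 (α zero) v {{α-nonZero {suc m} zero}} (norm-α-zero m)) (⊖α-zero v)
s≗move (suc i) v = trans
  (reflection-norm-2 (α (suc i)) v {{α-nonZero (suc i)}} (norm-α-suc i)) (⊖α-suc i v)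

⟦⟧≗act : (is : List (Fin m)) → ⟦ is ⟧ ≗ act -_ is
⟦⟧≗act []       v = refl
⟦⟧≗act (i ∷ is) v = trans (cong (s i) (⟦⟧≗act is v)) (s≗move i _)

swap-involutive : (i : Fin m) → Involutive _≡_ (swap {A = A} i)
swap-involutive zero    (x ∷ y ∷ v) = refl
swap-involutive (suc i) (x ∷ v)     = cong (x ∷_) (swap-involutive i v)

swap-map : (f : A → B) (i : Fin m) (v : Vec A (suc m)) →
           swap i (Vec.map f v) ≡ Vec.map f (swap i v)
swap-map f zero    (x ∷ y ∷ v) = refl
swap-map f (suc i) (x ∷ v)     = cong (f x ∷_) (swap-map f i v)

swap-zipWith : (f : A → A → A) (i : Fin m) (u v : Vec A (suc m)) →
               swap i (zipWith f u v) ≡ zipWith f (swap i u) (swap i v)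
swap-zipWith f zero    (x ∷ x′ ∷ u) (y ∷ y′ ∷ v) = refl
swap-zipWith f (suc i) (x ∷ u)      (y ∷ v)      = cong (f x y ∷_) (swap-zipWith f i u v)

swap-replicate : (i : Fin m) (x : A) → swap i (replicate (suc m) x) ≡ replicate (suc m) x
swap-replicate zero    x = refl
swap-replicate (suc i) x = cong (x ∷_) (swap-replicate i x)

swap-∷ʳ : (i : Fin m) (v : Vec A (suc m)) (x : A) → swap (inject₁ i) (v ∷ʳ x) ≡ swap i v ∷ʳ x
swap-∷ʳ zero    (y ∷ z ∷ v) x = refl
swap-∷ʳ (suc i) (y ∷ v)     x = cong (y ∷_) (swap-∷ʳ i v x)

move-involutive : Involutive _≡_ neg → (i : Fin m) → Involutive _≡_ (move neg i)
move-involutive inv zero    (x ∷ v) = cong (_∷ v) (inv x)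
move-involutive inv (suc i) v       = swap-involutive i v

-- With `f = sign` this transports computations with Booleans to the action on rational vectors.
act-map : {neg : A → A} {neg′ : B → B} (f : A → B) → neg′ ∘ f ≗ f ∘ neg →
          (is : List (Fin m)) → act neg′ is ∘ Vec.map f ≗ Vec.map f ∘ act neg is
act-map f hom []       v = refl
act-map {neg = neg} {neg′} f hom (i ∷ is) v =
  trans (cong (move neg′ i) (act-map f hom is v)) (move-map i (act neg is v))
  where
  move-map : ∀ i → move neg′ i ∘ Vec.map f ≗ Vec.map f ∘ move neg i
  move-map zero    (x ∷ v) = cong (_∷ Vec.map f v) (hom x)
  move-map (suc i) v       = swap-map f i v

act-∷ʳ : (is : List (Fin m)) (v : Vec A m) (x : A) →
         act neg (List.map inject₁ is) (v ∷ʳ x) ≡ act neg is v ∷ʳ x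
act-∷ʳ             []       v x = refl
act-∷ʳ {neg = neg} (i ∷ is) v x =
  trans (cong (move neg (inject₁ i)) (act-∷ʳ is v x)) (move-∷ʳ i (act neg is v))
  where
  move-∷ʳ : ∀ i v → move neg (inject₁ i) (v ∷ʳ x) ≡ move neg i v ∷ʳ x
  move-∷ʳ zero    (y ∷ v) = refl
  move-∷ʳ (suc i) v       = swap-∷ʳ i v x

-- Every generator is an involution, so the reversed word acts as the inverse.
act-reverse : Involutive _≡_ neg → (is : List (Fin m)) → ∀ v → act neg is (act neg (reverse is) v) ≡ v
act-reverse             inv []       v = refl
act-reverse {neg = neg} inv (i ∷ is) v = begin
  act neg (i ∷ is) (act neg (reverse (i ∷ is)) v)
    ≡⟨ cong (λ js → act neg (i ∷ is) (act neg js v)) (List.unfold-reverse i is) ⟩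
  act neg (i ∷ is) (act neg (reverse is List.∷ʳ i) v)
    ≡⟨ cong (act neg (i ∷ is)) (List.foldr-++ (move neg) v (reverse is) (i ∷ [])) ⟩
  move neg i (act neg is (act neg (reverse is) (move neg i v)))
    ≡⟨ cong (move neg i) (act-reverse inv is (move neg i v)) ⟩
  move neg i (move neg i v)
    ≡⟨ move-involutive inv i v ⟩
  v ∎
  where open ≡-Reasoning

act-reverseˡ : Involutive _≡_ neg → (is : List (Fin m)) → ∀ v → act neg (reverse is) (act neg is v) ≡ v
act-reverseˡ {neg = neg} inv is v =
  trans (cong (λ js → act neg (reverse is) (act neg js v)) (sym (List.reverse-involutive is)))
        (act-reverse inv (reverse is) v)

neg-involutive : Involutive _≡_ -_
neg-involutive = ⁻¹-involutive ℚ.+-0-group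

-- Sign vectors and cosets of W(A_{m-1})

sign : Bool → ℚ
sign false = 1ℚ
sign true  = - 1ℚ

signs : Vec Bool m → V m
signs = Vec.map sign

∅ : Vec Bool m
∅ = replicate _ false

sign-injective : ∀ {b c} → sign b ≡ sign c → b ≡ c
sign-injective {false} {false} _ = refl
sign-injective {true}  {true}  _ = refl

signs-injective : {b c : Vec Bool m} → signs b ≡ signs c → b ≡ c
signs-injective {b = []}    {[]}    _  = refl
signs-injective {b = x ∷ b} {y ∷ c} eq with p , q ← Vec.∷-injective eq =
  cong₂ _∷_ (sign-injective p) (signs-injective q)

⟦⟧-signs : (is : List (Fin m)) (b : Vec Bool m) → ⟦ is ⟧ (signs b) ≡ signs (act not is b)
⟦⟧-signs is b = trans (⟦⟧≗act is _) (act-map sign (λ { false → refl ; true → refl }) is b)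

infixl 7 _⊙_

_⊙_ : V m → V m → V m
_⊙_ = zipWith ℚ._*_

signs-∅-⊙ : (v : V m) → signs ∅ ⊙ v ≡ v
signs-∅-⊙ {m} v = trans (cong (_⊙ v) (Vec.map-replicate sign false m)) (Vec.zipWith-identityˡ ℚ.*-identityˡ v)

-- The filter uses the predicate from `WA`, so that `all-filter` yields membership in that subgroup.
unsigned : List (Fin m) → List (Fin m)
unsigned = List.filter (λ i → 2 ℕ.≤? index i)

-- Swaps distribute over componentwise products, whereas negating the first coordinate can be
-- charged to the left factor alone; the right factor thus meets only the swaps.
act-⊙ : (is : List (Fin m)) (u v : V m) →
        act -_ is (u ⊙ v) ≡ act -_ is u ⊙ act -_ (unsigned is) v
act-⊙ []           u v = refl
act-⊙ (zero ∷ is)  u v = trans (cong (move -_ zero) (act-⊙ is u v)) (negate-head (act -_ is u) _)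
  where
  negate-head : (u v : V (suc n)) → move -_ zero (u ⊙ v) ≡ move -_ zero u ⊙ v
  negate-head (x ∷ u) (y ∷ v) = cong (_∷ u ⊙ v) (ℚ.neg-distribˡ-* x y)
act-⊙ (suc i ∷ is) u v = trans (cong (swap i) (act-⊙ is u v)) (swap-zipWith ℚ._*_ i _ _)

-- Dropping the sign changes of a word splits ⟦ is ⟧ v as ⟦ is ⟧ (1,…,1) ⊙ (a word
-- in s₂,…,s_m applied to v), and here the first factor is trivial.
fixes-∅⇒WA : (is : List (Fin m)) → act not is ∅ ≡ ∅ → ⟦ is ⟧ ∈ WA m
fixes-∅⇒WA is fix = unsigned is , all-filter _ is , λ v → begin
  ⟦ is ⟧ v                                              ≡⟨ ⟦⟧≗act is v ⟩
  act -_ is v                                         ≡⟨ cong (act -_ is) (signs-∅-⊙ v) ⟨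
  act -_ is (signs ∅ ⊙ v)                             ≡⟨ act-⊙ is (signs ∅) v ⟩
  act -_ is (signs ∅) ⊙ act -_ (unsigned is) v      ≡⟨ cong₂ _⊙_ fix′ (sym (⟦⟧≗act (unsigned is) v)) ⟩
  signs ∅ ⊙ ⟦ unsigned is ⟧ v                           ≡⟨ signs-∅-⊙ _ ⟩
  ⟦ unsigned is ⟧ v                                     ∎
  where
  open ≡-Reasoning
  fix′ : act -_ is (signs ∅) ≡ signs ∅
  fix′ = trans (sym (⟦⟧≗act is _)) (trans (⟦⟧-signs is ∅) (cong signs fix))

-- The word `reverse js ++ is` represents the inverse of w composed with x. It fixes `∅`, hence lies
-- in W(A_{m-1}).
∈-coset : {w x : V m → V m} (is js : List (Fin m)) → x ≗ ⟦ is ⟧ → w ≗ ⟦ js ⟧ →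
          act not is ∅ ≡ act not js ∅ → x ∈ [ w ]
∈-coset {w = w} {x} is js x≗ w≗ eq = ⟦ ks ⟧ , fixes-∅⇒WA ks fix , λ v → begin
  x v                                                  ≡⟨ x≗ v ⟩
  ⟦ is ⟧ v                                             ≡⟨ ⟦⟧≗act is v ⟩
  act -_ is v                                        ≡⟨ act-reverse neg-involutive js _ ⟨
  act -_ js (act -_ (reverse js) (act -_ is v))  ≡⟨ cong (act -_ js) (List.foldr-++ _ v (reverse js) is) ⟨
  act -_ js (act -_ ks v)                          ≡⟨ cong (act -_ js) (⟦⟧≗act ks v) ⟨
  act -_ js (⟦ ks ⟧ v)                               ≡⟨ ⟦⟧≗act js _ ⟨
  ⟦ js ⟧ (⟦ ks ⟧ v)                                    ≡⟨ w≗ _ ⟨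
  w (⟦ ks ⟧ v)                                         ∎
  where
  open ≡-Reasoning
  ks = reverse js ++ is
  fix : act not ks ∅ ≡ ∅
  fix = begin
    act not ks ∅                           ≡⟨ List.foldr-++ _ ∅ (reverse js) is ⟩
    act not (reverse js) (act not is ∅)    ≡⟨ cong (act not (reverse js)) eq ⟩
    act not (reverse js) (act not js ∅)    ≡⟨ act-reverseˡ not-involutive js ∅ ⟩
    ∅                                      ∎

WA-signs-∅ : {u : V m → V m} → u ∈ WA m → u (signs ∅) ≡ signs ∅
WA-signs-∅ {m} (is , ≥2 , u≗) = trans (u≗ _) (trans (⟦⟧-signs is ∅) (cong signs (fixes is ≥2)))
  where
  fixes : (is : List (Fin m)) → All (λ i → 2 ≤ index i) is → act not is ∅ ≡ ∅
  fixes []           []             = refl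
  fixes (zero ∷ is)  (s≤s () ∷ _)
  fixes (suc i ∷ is) (_ ∷ ≥2)       = trans (cong (swap i) (fixes is ≥2)) (swap-replicate i false)

-- The converse of `∈-coset`: elements of W(A_{m-1}) only permute coordinates and so fix (1,...,1).
-- The sign vector is therefore a complete invariant of cosets.
coset-signs-∅ : {w x : V m → V m} → x ∈ [ w ] → x (signs ∅) ≡ w (signs ∅)
coset-signs-∅ {w = w} (u , u∈ , x≗) = trans (x≗ _) (cong w (WA-signs-∅ u∈))

extend-⟦⟧ : {y : V m → V m} (is : List (Fin m)) → y ≗ ⟦ is ⟧ →
            extend y ≗ ⟦ List.map inject₁ is ⟧
extend-⟦⟧ {y = y} is y≗ v with Vec.initLast v
... | u , x , refl = begin
  y u ∷ʳ x                                 ≡⟨ cong (_∷ʳ x) (trans (y≗ u) (⟦⟧≗act is u)) ⟩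
  act -_ is u ∷ʳ x                       ≡⟨ act-∷ʳ is u x ⟨
  act -_ (List.map inject₁ is) (u ∷ʳ x)  ≡⟨ ⟦⟧≗act (List.map inject₁ is) (u ∷ʳ x) ⟨
  ⟦ List.map inject₁ is ⟧ (u ∷ʳ x)         ∎
  where open ≡-Reasoning

⟦++⟧ : (is js : List (Fin m)) → ⟦ is ++ js ⟧ ≗ ⟦ is ⟧ ∘ ⟦ js ⟧
⟦++⟧ []       js v = refl
⟦++⟧ (i ∷ is) js v = cong (s i) (⟦++⟧ is js v)

-- The words w_j, w_J and 𝓘_j

swaps : List (Fin m) → Vec A (suc m) → Vec A (suc m)
swaps is v = List.foldr swap v is

act-map-suc : (is : List (Fin m)) (v : Vec A (suc m)) → act neg (List.map suc is) v ≡ swaps is v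
act-map-suc {neg = neg} is v = List.foldr-map (move neg) suc v is

swaps-map-suc : (is : List (Fin m)) (x : A) (v : Vec A (suc m)) →
                swaps (List.map suc is) (x ∷ v) ≡ x ∷ swaps is v
swaps-map-suc []       x v = refl
swaps-map-suc (i ∷ is) x v = cong (swap (suc i)) (swaps-map-suc is x v)

allFin-suc : ∀ m → allFin (suc m) ≡ zero ∷ List.map suc (allFin m)
allFin-suc m = cong (zero ∷_) (sym (List.map-tabulate id suc))

filter-map : {P : Pred B 0ℓ} {Q : Pred A 0ℓ} (P? : Decidable P) (Q? : Decidable Q) (f : A → B) →
             (∀ x → does (P? (f x)) ≡ does (Q? x)) →
             ∀ xs → List.filter P? (List.map f xs) ≡ List.map f (List.filter Q? xs)
filter-map P? Q? f eq []       = refl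
filter-map P? Q? f eq (x ∷ xs) rewrite eq x with does (Q? x)
... | true  = cong (f x ∷_) (filter-map P? Q? f eq xs)
... | false = filter-map P? Q? f eq xs

descending-zero : ∀ m → descending m 0 ≡ []
descending-zero m = cong reverse
  (List.filter-none (λ i → index i ℕ.≤? 0) (All.universal (λ _ ()) (allFin m)))

descending-suc : ∀ m b → descending (suc m) (suc b) ≡ List.map suc (descending m b) List.∷ʳ zero
descending-suc m b = begin
  reverse (List.filter P? (allFin (suc m)))
    ≡⟨ cong (reverse ∘ List.filter P?) (allFin-suc m) ⟩
  reverse (zero ∷ List.filter P? (List.map suc (allFin m)))
    ≡⟨ List.unfold-reverse zero (List.filter P? (List.map suc (allFin m))) ⟩
  reverse (List.filter P? (List.map suc (allFin m))) List.∷ʳ zero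
    ≡⟨ cong (λ is → reverse is List.∷ʳ zero) (filter-map P? Q? suc (λ _ → refl) (allFin m)) ⟩
  reverse (List.map suc (List.filter Q? (allFin m))) List.∷ʳ zero
    ≡⟨ cong (List._∷ʳ zero) (List.reverse-map suc (List.filter Q? (allFin m))) ⟨
  List.map suc (descending m b) List.∷ʳ zero ∎
  where
  open ≡-Reasoning
  P? = λ (i : Fin (suc m)) → index i ℕ.≤? suc b
  Q? = λ (i : Fin m) → index i ℕ.≤? b

ascending-1 : ∀ m → ascending (suc m) 1 ≡ zero ∷ List.map suc (ascending m 1)
ascending-1 m = trans (cong (List.filter (λ i → 1 ℕ.≤? index i)) (allFin-suc m))
  (cong (zero ∷_) (filter-map (λ i → 1 ℕ.≤? index i) (λ i → 1 ℕ.≤? index i) suc (λ _ → refl) (allFin m)))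

ascending-suc : ∀ m c → ascending (suc m) (suc (suc c)) ≡ List.map suc (ascending m (suc c))
ascending-suc m c = trans (cong (List.filter (λ i → suc (suc c) ℕ.≤? index i)) (allFin-suc m))
  (filter-map (λ i → suc (suc c) ℕ.≤? index i) (λ i → suc c ℕ.≤? index i) suc (λ _ → refl) (allFin m))

-- The rightmost letter acts first, so the head is carried to the right, one place per letter.
swaps-descending : (p : Fin (suc m)) (x : A) (v : Vec A m) →
                   swaps (descending m (toℕ p)) (x ∷ v) ≡ insertAt v p x
swaps-descending {m} zero x v rewrite descending-zero m = refl
swaps-descending {suc m} (suc p) x (y ∷ v) = begin
  swaps (descending (suc m) (suc (toℕ p))) (x ∷ y ∷ v)
    ≡⟨ cong (λ is → swaps is (x ∷ y ∷ v)) (descending-suc m (toℕ p)) ⟩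
  swaps (List.map suc (descending m (toℕ p)) List.∷ʳ zero) (x ∷ y ∷ v)
    ≡⟨ List.foldr-++ swap (x ∷ y ∷ v) (List.map suc (descending m (toℕ p))) (zero ∷ []) ⟩
  swaps (List.map suc (descending m (toℕ p))) (y ∷ x ∷ v)
    ≡⟨ swaps-map-suc (descending m (toℕ p)) y (x ∷ v) ⟩
  y ∷ swaps (descending m (toℕ p)) (x ∷ v)
    ≡⟨ cong (y ∷_) (swaps-descending p x v) ⟩
  y ∷ insertAt v p x ∎
  where open ≡-Reasoning

-- Here the rightmost letter is the largest one, so the last entry travels to the left and stops at
-- position p.
swaps-ascending : (p : Fin (suc m)) (x : A) (v : Vec A m) →
                  swaps (ascending m (suc (toℕ p))) (v ∷ʳ x) ≡ insertAt v p x
swaps-ascending zero x [] = refl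
swaps-ascending {suc m} zero x (y ∷ v) =
  trans (cong (λ is → swaps is (y ∷ (v ∷ʳ x))) (ascending-1 m)) (cong (swap zero)
  (trans (swaps-map-suc (ascending m 1) y (v ∷ʳ x)) (cong (y ∷_) (swaps-ascending zero x v))))
swaps-ascending {suc m} (suc p) x (y ∷ v) =
  trans (cong (λ is → swaps is (y ∷ (v ∷ʳ x))) (ascending-suc m (toℕ p)))
  (trans (swaps-map-suc (ascending m (index p)) y (v ∷ʳ x)) (cong (y ∷_) (swaps-ascending p x v)))

act-descending : (p : Fin (suc m)) (x : A) (v : Vec A m) →
                 act neg (descending (suc m) (index p)) (x ∷ v) ≡ insertAt v p (neg x)
act-descending {m} {neg = neg} p x v = begin
  act neg (descending (suc m) (index p)) (x ∷ v)
    ≡⟨ cong (λ is → act neg is (x ∷ v)) (descending-suc m (toℕ p)) ⟩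
  act neg (List.map suc (descending m (toℕ p)) List.∷ʳ zero) (x ∷ v)
    ≡⟨ List.foldr-++ (move neg) (x ∷ v) (List.map suc (descending m (toℕ p))) (zero ∷ []) ⟩
  act neg (List.map suc (descending m (toℕ p))) (neg x ∷ v)
    ≡⟨ act-map-suc (descending m (toℕ p)) (neg x ∷ v) ⟩
  swaps (descending m (toℕ p)) (neg x ∷ v)
    ≡⟨ swaps-descending p (neg x) v ⟩
  insertAt v p (neg x) ∎
  where open ≡-Reasoning

act-ascending : (p : Fin (suc m)) (x : A) (v : Vec A m) →
                act neg (ascending (suc m) (suc (index p))) (v ∷ʳ x) ≡ insertAt v p x
act-ascending {m} {neg = neg} p x v = begin
  act neg (ascending (suc m) (suc (index p))) (v ∷ʳ x)
    ≡⟨ cong (λ is → act neg is (v ∷ʳ x)) (ascending-suc m (toℕ p)) ⟩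
  act neg (List.map suc (ascending m (index p))) (v ∷ʳ x)
    ≡⟨ act-map-suc (ascending m (index p)) (v ∷ʳ x) ⟩
  swaps (ascending m (index p)) (v ∷ʳ x)
    ≡⟨ swaps-ascending p x v ⟩
  insertAt v p x ∎
  where open ≡-Reasoning

insertAt-last : (p : Fin (suc m)) (x : A) (v : Vec A m) → toℕ p ≡ m → insertAt v p x ≡ v ∷ʳ x
insertAt-last zero    x []      eq = refl
insertAt-last (suc p) x (y ∷ v) eq = cong (y ∷_) (insertAt-last p x v (ℕ.suc-injective eq))

𝓘-≤ : ∀ j → suc j ≤ m → 𝓘 m (suc j) ≡ ascending (suc m) (m + 2 ∸ suc j)
𝓘-≤ {m} j j<m = cong (if_then ascending (suc m) (m + 2 ∸ suc j)
                      else (descending (suc m) (suc j ∸ m) ++ ascending (suc m) 2))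
                     (dec-true (suc j ℕ.≤? m) j<m)

𝓘-> : ∀ j → m < suc j → 𝓘 m (suc j) ≡ descending (suc m) (suc j ∸ m) ++ ascending (suc m) 2
𝓘-> {m} j m≤j = cong (if_then ascending (suc m) (m + 2 ∸ suc j)
                      else (descending (suc m) (suc j ∸ m) ++ ascending (suc m) 2))
                     (dec-false (suc j ℕ.≤? m) (ℕ.<⇒≱ m≤j))

-- For j ≤ m the appended entry travels j places to the left and never meets the sign change; j = 0
-- leaves it at the end.
𝓘-insert-false : ∀ j (p : Fin (suc m)) (v : Vec Bool m) → j ≤ m → toℕ p ≡ m ∸ j →
                 act not (𝓘 m j) (v ∷ʳ false) ≡ insertAt v p false
𝓘-insert-false zero p v _ eq = sym (insertAt-last p false v eq)
𝓘-insert-false {m} j@(suc _) p v j≤m eq = begin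
  act not (𝓘 m j) (v ∷ʳ false)
    ≡⟨ cong (λ is → act not is (v ∷ʳ false)) (𝓘-≤ _ j≤m) ⟩
  act not (ascending (suc m) (m + 2 ∸ j)) (v ∷ʳ false)
    ≡⟨ cong (λ c → act not (ascending (suc m) c) (v ∷ʳ false)) start ⟩
  act not (ascending (suc m) (suc (index p))) (v ∷ʳ false)
    ≡⟨ act-ascending p false v ⟩
  insertAt v p false ∎
  where
  open ≡-Reasoning
  -- The swap acting last is s_{p+2}, which exchanges positions p and p + 1 counted from 0.
  start : m + 2 ∸ j ≡ suc (index p)
  start = begin
    m + 2 ∸ j          ≡⟨ cong (_∸ j) (ℕ.+-comm m 2) ⟩
    2 + m ∸ j          ≡⟨ ℕ.+-∸-assoc 2 j≤m ⟩
    2 + (m ∸ j)        ≡⟨ cong (2 ℕ.+_) eq ⟨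
    suc (index p)      ∎

-- The ascending part brings the appended entry to the front; the descending part negates it there
-- and carries it to position p.
𝓘-insert-true : (p : Fin (suc m)) (v : Vec Bool m) →
                act not (𝓘 m (suc (m + toℕ p))) (v ∷ʳ false) ≡ insertAt v p true
𝓘-insert-true {m} p v = begin
  act not (𝓘 m j) (v ∷ʳ false)
    ≡⟨ cong (λ is → act not is (v ∷ʳ false)) (𝓘-> _ (s≤s (ℕ.m≤m+n m (toℕ p)))) ⟩
  act not (descending (suc m) (j ∸ m) ++ ascending (suc m) 2) (v ∷ʳ false)
    ≡⟨ List.foldr-++ (move not) _ (descending (suc m) (j ∸ m)) _ ⟩
  act not (descending (suc m) (j ∸ m)) (act not (ascending (suc m) 2) (v ∷ʳ false))
    ≡⟨ cong₂ (λ b → act not (descending (suc m) b)) end (act-ascending zero false v) ⟩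
  act not (descending (suc m) (index p)) (false ∷ v)
    ≡⟨ act-descending p false v ⟩
  insertAt v p true ∎
  where
  open ≡-Reasoning
  j = suc (m + toℕ p)
  end : j ∸ m ≡ index p
  end = trans (cong (_∸ m) (sym (ℕ.+-suc m (toℕ p)))) (ℕ.m+n∸m≡n m (index p))

𝓘⇒insertAt : ∀ j → j ≤ 2 ℕ.* m + 1 → (v : Vec Bool m) →
             ∃[ p ] ∃[ b ] act not (𝓘 m j) (v ∷ʳ false) ≡ insertAt v p b
𝓘⇒insertAt {m} j j≤ v with j ℕ.≤? m
... | yes j≤m = fromℕ< m∸j<1+m , false , 𝓘-insert-false j _ v j≤m (Fin.toℕ-fromℕ< m∸j<1+m)
  where m∸j<1+m = s≤s (ℕ.m∸n≤m m j)
... | no  j≰m = fromℕ< k<1+m , true ,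
  trans (cong (λ i → act not (𝓘 m i) (v ∷ʳ false)) j≡) (𝓘-insert-true _ v)
  where
  -- Writing j = m + 1 + k, the bound j ≤ 2m + 1 becomes k ≤ m, so k is a valid position.
  k = j ∸ suc m
  k<1+m : k < suc m
  k<1+m = s≤s (ℕ.≤-trans (ℕ.∸-monoˡ-≤ (suc m) j≤) (ℕ.≤-reflexive
    (trans (cong (_∸ suc m) (trans (ℕ.+-comm (2 ℕ.* m) 1) (cong (λ l → suc (m + l)) (ℕ.+-identityʳ m)))) (ℕ.m+n∸m≡n m m))))
  j≡ : j ≡ suc (m + toℕ (fromℕ< k<1+m))
  j≡ = trans (sym (ℕ.m+[n∸m]≡n (ℕ.≰⇒> j≰m))) (cong (λ l → suc (m + l)) (sym (Fin.toℕ-fromℕ< k<1+m)))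

insertAt⇒𝓘 : ∀ p b (v : Vec Bool m) →
             ∃[ j ] j ≤ 2 ℕ.* m + 1 × act not (𝓘 m j) (v ∷ʳ false) ≡ insertAt v p b
insertAt⇒𝓘 {m} p false v = m ∸ toℕ p , ℕ.≤-trans (ℕ.m∸n≤m m (toℕ p)) (ℕ.≤-trans (ℕ.m≤m+n m _) (ℕ.m≤m+n (2 ℕ.* m) 1)) ,
  𝓘-insert-false (m ∸ toℕ p) p v (ℕ.m∸n≤m m (toℕ p)) (sym (ℕ.m∸[m∸n]≡n (Fin.toℕ≤pred[n] p)))
insertAt⇒𝓘 {m} p true v = suc (m + toℕ p) , bound , 𝓘-insert-true p v
  where
  bound : suc (m + toℕ p) ≤ 2 ℕ.* m + 1
  bound = begin
    suc (m + toℕ p)   ≤⟨ s≤s (ℕ.+-monoʳ-≤ m (Fin.toℕ≤pred[n] p)) ⟩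
    suc (m + m)       ≡⟨ cong (λ l → suc (m + l)) (ℕ.+-identityʳ m) ⟨
    suc (2 ℕ.* m)     ≡⟨ ℕ.+-comm 1 (2 ℕ.* m) ⟩
    2 ℕ.* m + 1       ∎
    where open ℕ.≤-Reasoning

-- The sign vector of w_J

elements : Subset m → List (Fin m)
elements {m} J = List.filter (_∈? J) (allFin m)

elements-true : (J : Subset m) → elements (true ∷ J) ≡ zero ∷ List.map suc (elements J)
elements-true {m} J = trans (cong (List.filter (_∈? (true ∷ J))) (allFin-suc m))
  (cong (zero ∷_) (filter-map (_∈? (true ∷ J)) (_∈? J) suc (λ _ → refl) (allFin m)))

elements-false : (J : Subset m) → elements (false ∷ J) ≡ List.map suc (elements J)
elements-false {m} J = trans (cong (List.filter (_∈? (false ∷ J))) (allFin-suc m))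
  (filter-map (_∈? (false ∷ J)) (_∈? J) suc (λ _ → refl) (allFin m))

-- The effect of w_{i+1} on sign vectors.
rotate : Fin m → Vec Bool m → Vec Bool m
rotate i (x ∷ v) = insertAt v i (not x)

rotates : List (Fin m) → Vec Bool m
rotates is = List.foldr rotate ∅ is

act-concatMap-descending : (is : List (Fin m)) →
                           act not (concatMap (descending m ∘ index) is) ∅ ≡ rotates is
act-concatMap-descending []       = refl
act-concatMap-descending {m} (i ∷ is) = begin
  act not (descending m (index i) ++ concatMap (descending m ∘ index) is) ∅
    ≡⟨ List.foldr-++ (move not) ∅ (descending m (index i)) _ ⟩
  act not (descending m (index i)) (act not (concatMap (descending m ∘ index) is) ∅)
    ≡⟨ cong (act not (descending m (index i))) (act-concatMap-descending is) ⟩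
  act not (descending m (index i)) (rotates is)
    ≡⟨ act-rotate i (rotates is) ⟩
  rotate i (rotates is) ∎
  where
  open ≡-Reasoning
  act-rotate : ∀ {m} (i : Fin m) v → act not (descending m (index i)) v ≡ rotate i v
  act-rotate i (x ∷ v) = act-descending i x v

-- Clear i v: the entries of v up to position i are all false, so that w_{i+1}
-- merely sets position i. The letters of w_J act from the largest to the smallest
-- element of J, hence always in this situation.
data Clear : Fin m → Vec Bool m → Set where
  zero : {v : Vec Bool m} → Clear zero (false ∷ v)
  suc  : {i : Fin m} {v : Vec Bool m} → Clear i v → Clear (suc i) (false ∷ v)

data Increasing : List (Fin m) → Set where
  []  : Increasing {m} []
  _∷_ : {i : Fin m} {is : List (Fin m)} →
        Clear i (rotates is) → Increasing is → Increasing (i ∷ is)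

-- The head of `v` is `false` by `Clear`. Hence it can become the new head, and flipping either of
-- the two leading entries produces the same `true` to be moved.
rotate-suc : {i : Fin m} {v : Vec Bool m} → Clear i v → rotate (suc i) (false ∷ v) ≡ false ∷ rotate i v
rotate-suc zero    = refl
rotate-suc (suc _) = refl

rotates-map-suc : {is : List (Fin m)} → Increasing is → rotates (List.map suc is) ≡ false ∷ rotates is
rotates-map-suc []                   = refl
rotates-map-suc {is = i ∷ _} (c ∷ r) = trans (cong (rotate (suc i)) (rotates-map-suc r)) (rotate-suc c)

Increasing-map-suc : {is : List (Fin m)} → Increasing is → Increasing (List.map suc is)
Increasing-map-suc []      = []
Increasing-map-suc (c ∷ r) = subst (Clear _) (sym (rotates-map-suc r)) (suc c) ∷ Increasing-map-suc r

-- `Increasing` is carried along because shifting all letters by one prepends a `false` only for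
-- such lists.
rotates-elements : (J : Subset m) → Increasing (elements J) × rotates (elements J) ≡ J
rotates-elements []          = [] , refl
rotates-elements (true ∷ J)  with r , eq ← rotates-elements J =
  subst (λ is → Increasing is × rotates is ≡ true ∷ J) (sym (elements-true J))
    ( subst (Clear zero) (sym (rotates-map-suc r)) zero ∷ Increasing-map-suc r
    , trans (cong (rotate zero) (rotates-map-suc r)) (cong (true ∷_) eq))
rotates-elements (false ∷ J) with r , eq ← rotates-elements J =
  subst (λ is → Increasing is × rotates is ≡ false ∷ J) (sym (elements-false J))
    (Increasing-map-suc r , trans (rotates-map-suc r) (cong (false ∷_) eq))

-- Every sign vector thus comes from some w_J, so each coset contains one, and J can be read off
-- from the map w_J.
act-w[] : (J : Subset m) → act not w[ J ] ∅ ≡ J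
act-w[] J = trans (act-concatMap-descending (elements J)) (proj₂ (rotates-elements J))

-- Weight and length

bit : Bool → ℕ
bit false = 0
bit true  = 1

ones weight : Vec Bool m → ℕ
ones v = Vec.sum (Vec.map bit v)
-- This is Σ_{j∈J} j: prepending an entry raises every element of J by one.
weight []      = 0
weight (b ∷ v) = ones (b ∷ v) + weight v

length-descending : (p : Fin (suc m)) → length (descending m (toℕ p)) ≡ toℕ p
length-descending {m} zero = cong length (descending-zero m)
length-descending {suc m} (suc p) = begin
  length (descending (suc m) (suc (toℕ p)))           ≡⟨ cong length (descending-suc m (toℕ p)) ⟩
  length (List.map suc (descending m (toℕ p)) List.∷ʳ zero) ≡⟨ List.length-++ (List.map suc (descending m (toℕ p))) ⟩
  length (List.map suc (descending m (toℕ p))) + 1     ≡⟨ cong (_+ 1) (List.length-map suc (descending m (toℕ p))) ⟩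
  length (descending m (toℕ p)) + 1                    ≡⟨ cong (_+ 1) (length-descending p) ⟩
  toℕ p + 1                                            ≡⟨ ℕ.+-comm (toℕ p) 1 ⟩
  suc (toℕ p)                                          ∎
  where open ≡-Reasoning

sum-index : List (Fin m) → ℕ
sum-index is = sum (List.map index is)

length-concatMap-descending : (is : List (Fin m)) →
                              length (concatMap (descending m ∘ index) is) ≡ sum-index is
length-concatMap-descending []           = refl
length-concatMap-descending {m} (i ∷ is) = trans (List.length-++ (descending m (index i)))
  (cong₂ _+_ (length-descending (suc i)) (length-concatMap-descending is))

sum-index-map-suc : (is : List (Fin m)) → sum-index (List.map suc is) ≡ length is + sum-index is
sum-index-map-suc []       = refl
sum-index-map-suc (i ∷ is) = cong suc (begin
  index i + sum-index (List.map suc is)      ≡⟨ cong (index i ℕ.+_) (sum-index-map-suc is) ⟩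
  index i + (length is + sum-index is)       ≡⟨ ℕ.+-assoc (index i) _ _ ⟨
  index i + length is + sum-index is         ≡⟨ cong (_+ sum-index is) (ℕ.+-comm (index i) _) ⟩
  length is + index i + sum-index is         ≡⟨ ℕ.+-assoc (length is) _ _ ⟩
  length is + (index i + sum-index is)       ∎)
  where open ≡-Reasoning

length-elements : (J : Subset m) → length (elements J) ≡ ones J
length-elements []          = refl
length-elements (true ∷ J)  = trans (cong length (elements-true J))
  (cong suc (trans (List.length-map suc (elements J)) (length-elements J)))
length-elements (false ∷ J) = trans (cong length (elements-false J))
  (trans (List.length-map suc (elements J)) (length-elements J))

sum-index-elements : (J : Subset m) → sum-index (elements J) ≡ weight J
sum-index-elements []      = refl
sum-index-elements (b ∷ J) = begin
  sum-index (elements (b ∷ J))                      ≡⟨ head b ⟩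
  bit b + sum-index (List.map suc (elements J))     ≡⟨ cong (bit b ℕ.+_) (sum-index-map-suc (elements J)) ⟩
  bit b + (length (elements J) + sum-index (elements J))
    ≡⟨ cong (bit b ℕ.+_) (cong₂ _+_ (length-elements J) (sum-index-elements J)) ⟩
  bit b + (ones J + weight J)                       ≡⟨ ℕ.+-assoc (bit b) (ones J) (weight J) ⟨
  weight (b ∷ J)                                    ∎
  where
  open ≡-Reasoning
  head : ∀ b → sum-index (elements (b ∷ J)) ≡ bit b + sum-index (List.map suc (elements J))
  head true  = cong sum-index (elements-true J)
  head false = cong sum-index (elements-false J)

length-w[] : (J : Subset m) → length w[ J ] ≡ weight J
length-w[] J = trans (length-concatMap-descending (elements J)) (sum-index-elements J)

ones-∅ : ∀ m → ones (∅ {m}) ≡ 0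
ones-∅ zero    = refl
ones-∅ (suc m) = ones-∅ m

weight-∅ : ∀ m → weight (∅ {m}) ≡ 0
weight-∅ zero    = refl
weight-∅ (suc m) = cong₂ _+_ (ones-∅ m) (weight-∅ m)

ones-swap : (i : Fin m) (v : Vec Bool (suc m)) → ones (swap i v) ≡ ones v
ones-swap zero    (x ∷ y ∷ v) = trans (sym (ℕ.+-assoc (bit y) _ _))
  (trans (cong (_+ ones v) (ℕ.+-comm (bit y) (bit x))) (ℕ.+-assoc (bit x) _ _))
ones-swap (suc i) (x ∷ v)     = cong (bit x ℕ.+_) (ones-swap i v)

bit≤1 : ∀ b → bit b ≤ 1
bit≤1 false = z≤n
bit≤1 true  = s≤s z≤n

-- The weight adds up the numbers of ones in all suffixes, and a swap affects only the suffix
-- starting at the second of the two entries.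
weight-swap : (i : Fin m) (v : Vec Bool (suc m)) → weight (swap i v) ≤ suc (weight v)
weight-swap zero (x ∷ y ∷ v) = begin
  ones (y ∷ x ∷ v) + (ones (x ∷ v) + weight v)       ≡⟨ cong (_+ (ones (x ∷ v) + weight v)) (ones-swap zero (x ∷ y ∷ v)) ⟩
  ones (x ∷ y ∷ v) + (bit x + ones v + weight v)     ≤⟨ ℕ.+-monoʳ-≤ (ones (x ∷ y ∷ v)) (ℕ.+-monoˡ-≤ (weight v)
                                                         (ℕ.+-mono-≤ (bit≤1 x) (ℕ.m≤n+m (ones v) (bit y)))) ⟩
  ones (x ∷ y ∷ v) + suc (ones (y ∷ v) + weight v)   ≡⟨ ℕ.+-suc (ones (x ∷ y ∷ v)) _ ⟩
  suc (ones (x ∷ y ∷ v) + (ones (y ∷ v) + weight v)) ∎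
  where open ℕ.≤-Reasoning
weight-swap (suc i) (x ∷ v) = begin
  bit x + ones (swap i v) + weight (swap i v) ≤⟨ ℕ.+-mono-≤ (ℕ.≤-reflexive (cong (bit x ℕ.+_) (ones-swap i v))) (weight-swap i v) ⟩
  bit x + ones v + suc (weight v)             ≡⟨ ℕ.+-suc (bit x + ones v) (weight v) ⟩
  suc (bit x + ones v + weight v)             ∎
  where open ℕ.≤-Reasoning

weight-move : (i : Fin m) (v : Vec Bool m) → weight (move not i v) ≤ suc (weight v)
weight-move zero    (x ∷ v) = ℕ.+-monoˡ-≤ (weight v) (ℕ.+-mono-≤ (bit≤1 (not x)) (ℕ.m≤n+m (ones v) (bit x)))
weight-move (suc i) v       = weight-swap i v

-- The weight starts at 0 and grows by at most one per letter; this is the lower bound for lengths.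
weight≤length : (is : List (Fin m)) → weight (act not is ∅) ≤ length is
weight≤length {m} []   = ℕ.≤-reflexive (weight-∅ m)
weight≤length (i ∷ is) = ℕ.≤-trans (weight-move i (act not is ∅)) (s≤s (weight≤length is))

-- Weights of insertions

-- The amount by which inserting b at position p raises the weight: b itself and
-- each 1 to the right of p contribute one, and an inserted 1 contributes p more.
offset : Vec Bool m → Fin (suc m) → Bool → ℕ
offset v       zero    b = bit b + ones v
offset (x ∷ v) (suc p) b = bit b + offset v p b

ones-insertAt : (v : Vec Bool m) (p : Fin (suc m)) (b : Bool) → ones (insertAt v p b) ≡ bit b + ones v
ones-insertAt v       zero    b = refl
ones-insertAt (x ∷ v) (suc p) b = trans (cong (bit x ℕ.+_) (ones-insertAt v p b)) (x∙yz≈y∙xz (bit x) (bit b) (ones v))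

weight-insertAt : (v : Vec Bool m) (p : Fin (suc m)) (b : Bool) →
                  weight (insertAt v p b) ≡ offset v p b + weight v
weight-insertAt v       zero    b = refl
weight-insertAt (x ∷ v) (suc p) b = trans
  (cong₂ (λ o w → bit x + o + w) (ones-insertAt v p b) (weight-insertAt v p b))
  (rearrange (bit x) (bit b) (ones v) (offset v p b) (weight v))
  where
  rearrange : ∀ x b o f w → x + (b + o) + (f + w) ≡ b + f + (x + o + w)
  rearrange = ℕ.solve-∀

ones≤ : (v : Vec Bool m) → ones v ≤ m
ones≤ []      = z≤n
ones≤ (x ∷ v) = ℕ.+-mono-≤ (bit≤1 x) (ones≤ v)

offset≤ : (v : Vec Bool m) (p : Fin (suc m)) (b : Bool) → offset v p b ≤ suc m
offset≤ v       zero    b = ℕ.+-mono-≤ (bit≤1 b) (ones≤ v)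
offset≤ (x ∷ v) (suc p) b = ℕ.+-mono-≤ (bit≤1 b) (offset≤ v p b)

-- An inserted `false` contributes only the ones to its right. Together with `ones<offset-true` this
-- separates the offsets of the two bits at the threshold `ones v`.
offset-false≤ones : (v : Vec Bool m) (p : Fin (suc m)) → offset v p false ≤ ones v
offset-false≤ones v       zero    = ℕ.≤-refl
offset-false≤ones (x ∷ v) (suc p) = ℕ.≤-trans (offset-false≤ones v p) (ℕ.m≤n+m (ones v) (bit x))

-- An inserted `true` contributes p + 1 and the ones to its right, and at most p ones lie to its
-- left.
ones<offset-true : (v : Vec Bool m) (p : Fin (suc m)) → ones v < offset v p true
ones<offset-true v       zero    = ℕ.≤-refl
ones<offset-true (x ∷ v) (suc p) = s≤s (ℕ.≤-trans (ℕ.+-monoˡ-≤ (ones v) (bit≤1 x)) (ones<offset-true v p))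

offset-bit-injective : (v : Vec Bool m) (p q : Fin (suc m)) (b c : Bool) → offset v p b ≡ offset v q c → b ≡ c
offset-bit-injective v p q false false _  = refl
offset-bit-injective v p q true  true  _  = refl
offset-bit-injective v p q false true  eq =
  contradiction eq (ℕ.<⇒≢ (ℕ.≤-<-trans (offset-false≤ones v p) (ones<offset-true v q)))
offset-bit-injective v p q true  false eq =
  contradiction (sym eq) (ℕ.<⇒≢ (ℕ.≤-<-trans (offset-false≤ones v q) (ones<offset-true v p)))

-- Equal offsets force every entry passed over to equal b, and moving a bit along a run of equal
-- bits does not change the word.
offset-zero-injective : (v : Vec Bool m) (q : Fin (suc m)) (b : Bool) →
                        offset v zero b ≡ offset v q b → b ∷ v ≡ insertAt v q b
offset-zero-injective v       zero    b eq = refl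
offset-zero-injective (x ∷ v) (suc q) b eq
  -- After cancellation the left side `bit x + ones v` is `offset v zero x`, so the offset
  -- determines the bit and x = b.
  with refl ← offset-bit-injective v zero q x b (ℕ.+-cancelˡ-≡ (bit b) _ _ eq) =
  cong (b ∷_) (offset-zero-injective v q b (ℕ.+-cancelˡ-≡ (bit b) _ _ eq))

offset-position-injective : (v : Vec Bool m) (p q : Fin (suc m)) (b : Bool) →
                            offset v p b ≡ offset v q b → insertAt v p b ≡ insertAt v q b
offset-position-injective v       zero    q       b eq = offset-zero-injective v q b eq
offset-position-injective v       (suc p) zero    b eq = sym (offset-zero-injective v (suc p) b (sym eq))
offset-position-injective (x ∷ v) (suc p) (suc q) b eq =
  cong (x ∷_) (offset-position-injective v p q b (ℕ.+-cancelˡ-≡ (bit b) _ _ eq))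

offset-injective : (v : Vec Bool m) (p q : Fin (suc m)) (b c : Bool) →
                   offset v p b ≡ offset v q c → insertAt v p b ≡ insertAt v q c
offset-injective v p q b c eq with refl ← offset-bit-injective v p q b c eq =
  offset-position-injective v p q b eq

-- As the position moves right, the offset falls from `ones v` to 0 in steps of at most one, so it
-- skips no value.
offset-false-surjective : (v : Vec Bool m) {d : ℕ} → d ≤ ones v → ∃[ p ] offset v p false ≡ d
offset-false-surjective []      z≤n = zero , refl
offset-false-surjective (x ∷ v) {d} d≤ with d ℕ.≟ ones (x ∷ v)
... | yes refl = zero , refl
... | no  d≢ with p , eq ← offset-false-surjective v
                   (s≤s⁻¹ (ℕ.≤-trans (ℕ.≤∧≢⇒< d≤ d≢) (ℕ.+-monoˡ-≤ (ones v) (bit≤1 x)))) = suc p , eq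

-- As the position moves right, the offset climbs from `ones v + 1` to m + 1: each step gains one
-- for the position and loses one only when it passes a 1.
offset-true-surjective : (v : Vec Bool m) {d : ℕ} → ones v ≤ d → d ≤ m → ∃[ p ] offset v p true ≡ suc d
offset-true-surjective []      z≤n z≤n = zero , refl
offset-true-surjective (x ∷ v) {d} ≤d d≤ with ones (x ∷ v) ℕ.≟ d
... | yes refl = zero , refl
offset-true-surjective (x ∷ v) {zero}  ≤d d≤ | no d≢ = contradiction (ℕ.n≤0⇒n≡0 ≤d) d≢
offset-true-surjective (x ∷ v) {suc d} ≤d d≤ | no d≢
  with p , eq ← offset-true-surjective v
         (ℕ.≤-trans (ℕ.m≤n+m (ones v) (bit x)) (s≤s⁻¹ (ℕ.≤∧≢⇒< ≤d d≢))) (s≤s⁻¹ d≤) = suc p , cong suc eq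

offset-surjective : (v : Vec Bool m) {d : ℕ} → d ≤ suc m → ∃[ p ] ∃[ b ] offset v p b ≡ d
offset-surjective v {d} d≤ with d ℕ.≤? ones v
... | yes d≤ones with p , eq ← offset-false-surjective v d≤ones = p , false , eq
offset-surjective v {zero}  d≤ | no d≰ones = contradiction z≤n d≰ones
offset-surjective v {suc d} d≤ | no d≰ones
  with p , eq ← offset-true-surjective v (s≤s⁻¹ (ℕ.≰⇒> d≰ones)) (s≤s⁻¹ d≤) = p , true , eq

-- Offsets in a prescribed residue class

residue-exists : ∀ a k N .{{_ : ℕ.NonZero N}} → ∃[ d ] d < N × (+ (d + k)) ≡ a [mod N ]
residue-exists a k N = d , ℤ.n%ℕd<d c N , ℤ.∣⇒∣ᵤ (ℤ.divides (ℤ.- q) (begin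
  + (d + k) ℤ.- a                        ≡⟨ cong (λ e → + (d + k) ℤ.- e) a≡ ⟩
  + (d + k) ℤ.- (+ d ℤ.+ q ℤ.* + N ℤ.+ + k) ≡⟨ cong (ℤ._- (+ d ℤ.+ q ℤ.* + N ℤ.+ + k)) (ℤ.pos-+ d k) ⟩
  + d ℤ.+ + k ℤ.- (+ d ℤ.+ q ℤ.* + N ℤ.+ + k) ≡⟨ cancel (+ d) (+ k) q (+ N) ⟩
  ℤ.- q ℤ.* + N                          ∎))
  where
  open ≡-Reasoning
  -- The offset to be realised is the remainder `d` of a - k modulo N; the quotient `q` witnesses
  -- the divisibility.
  c = a ℤ.- + k
  d = c ℤ.%ℕ N
  q = c ℤ./ℕ N
  restore : ∀ a k → a ≡ a ℤ.- k ℤ.+ k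
  restore = ℤ.solve-∀
  cancel : ∀ d k q N → d ℤ.+ k ℤ.- (d ℤ.+ q ℤ.* N ℤ.+ k) ≡ ℤ.- q ℤ.* N
  cancel = ℤ.solve-∀
  a≡ : a ≡ + d ℤ.+ q ℤ.* + N ℤ.+ + k
  a≡ = trans (restore a (+ k)) (cong (ℤ._+ + k) (ℤ.a≡a%ℕn+[a/ℕn]*n c N))

-- N divides d - e, whose absolute value is below N, so the difference vanishes.
residue-unique : ∀ a k {N d e} → d < N → e < N →
                 (+ (d + k)) ≡ a [mod N ] → (+ (e + k)) ≡ a [mod N ] → d ≡ e
residue-unique a k {N} {d} {e} d<N e<N ≡d ≡e =
  ℤ.+-injective (ℤ.i-j≡0⇒i≡j (+ d) (+ e) (ℤ.∣i∣≡0⇒i≡0 (small (ℤ.∣⇒∣ᵤ N∣d-e) ∣d-e∣<N)))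
  where
  difference : ∀ d e k a → (d ℤ.+ k ℤ.- a) ℤ.- (e ℤ.+ k ℤ.- a) ≡ d ℤ.- e
  difference = ℤ.solve-∀
  N∣d-e : + N ℤ.∣ + d ℤ.- + e
  N∣d-e = subst (+ N ℤ.∣_)
    (trans (cong₂ (λ x y → (x ℤ.- a) ℤ.- (y ℤ.- a)) (ℤ.pos-+ d k) (ℤ.pos-+ e k)) (difference (+ d) (+ e) (+ k) a))
    (ℤ.∣m∣n⇒∣m-n {+ N} {+ (d + k) ℤ.- a} {+ (e + k) ℤ.- a} (ℤ.∣ᵤ⇒∣ ≡d) (ℤ.∣ᵤ⇒∣ ≡e))
  ∣d-e∣<N : ℤ.∣ + d ℤ.- + e ∣ < N
  ∣d-e∣<N = ℕ.≤-<-trans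
    (ℕ.≤-trans (ℕ.≤-reflexive (cong ℤ.∣_∣ (ℤ.m-n≡m⊖n d e))) (ℤ.∣m⊝n∣≤m⊔n d e)) (ℕ.⊔-pres-<m d<N e<N)
  small : ∀ {k} → N ℕ.∣ k → k < N → k ≡ 0
  small {zero}  _   _   = refl
  small {suc k} N∣k k<N = contradiction N∣k (ℕ.>⇒∤ k<N)

-- Minimal representatives and insertion spheres

∅-∷ʳ : ∀ m → ∅ {suc m} ≡ ∅ {m} ∷ʳ false
∅-∷ʳ zero    = refl
∅-∷ʳ (suc m) = cong (false ∷_) (∅-∷ʳ m)

word-signs : {x : V m → V m} (is : List (Fin m)) → x ≗ ⟦ is ⟧ → x (signs ∅) ≡ signs (act not is ∅)
word-signs is x≗ = trans (x≗ (signs ∅)) (⟦⟧-signs is ∅)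

𝓜-signs : {x : V m → V m} (K : Subset m) → x ≗ ⟦ w[ K ] ⟧ → x (signs ∅) ≡ signs K
𝓜-signs K x≗ = trans (word-signs w[ K ] x≗) (cong signs (act-w[] K))

-- Any word for x turns `∅` into K, so the bound on the weight reached by a word applies.
weight-minimal : {x : V m → V m} (K : Subset m) → x (signs ∅) ≡ signs K →
                 ∀ is → x ≗ ⟦ is ⟧ → weight K ≤ length is
weight-minimal K x∅ is x≗ = subst (λ J → weight J ≤ length is)
  (signs-injective (trans (sym (word-signs is x≗)) x∅)) (weight≤length is)

length-𝓜 : {x : V m → V m} (K : Subset m) → x ≗ ⟦ w[ K ] ⟧ → HasLength x (weight K)
length-𝓜 K x≗ = (w[ K ] , x≗ , length-w[] K) , weight-minimal K (𝓜-signs K x≗)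

HasLength-unique : {x : V m → V m} {k l : ℕ} → HasLength x k → HasLength x l → k ≡ l
HasLength-unique ((is , x≗is , refl) , minₖ) ((js , x≗js , refl) , minₗ) =
  ℕ.≤-antisym (minₖ js x≗js) (minₗ is x≗is)

-- With K the sign vector of w, the element w_K lies in the coset. All members of the coset share K,
-- so none is shorter than the weight of K, which w_K attains.
minRep-𝓜 : {w : V m → V m} (js : List (Fin m)) → w ≗ ⟦ js ⟧ → MinRep w ⟦ w[ act not js ∅ ] ⟧
minRep-𝓜 {w = w} js w≗ =
  ∈-coset w[ K ] js (λ _ → refl) w≗ (act-w[] K) ,
  weight K , length-𝓜 K (λ _ → refl) ,
  λ { z _ z∈ ((is , z≗ , refl) , _) → weight-minimal K (trans (coset-signs-∅ {w = w} z∈) (word-signs js w≗)) is z≗ }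
  where K = act not js ∅

insertion-word : (j : ℕ) (J : Subset m) → List (Fin (suc m))
insertion-word {m} j J = 𝓘 m j ++ List.map inject₁ w[ J ]

insertion-word-≗ : {y : V m → V m} (j : ℕ) (J : Subset m) → y ≗ ⟦ w[ J ] ⟧ →
                   ⟦ 𝓘 m j ⟧ ∘ extend y ≗ ⟦ insertion-word j J ⟧
insertion-word-≗ {m} j J y≗ v =
  trans (cong ⟦ 𝓘 m j ⟧ (extend-⟦⟧ w[ J ] y≗ v)) (sym (⟦++⟧ (𝓘 m j) (List.map inject₁ w[ J ]) v))

-- The word for y leaves the new last coordinate positive, which accounts for the appended `false`.
act-insertion-word : (j : ℕ) (J : Subset m) → act not (insertion-word j J) ∅ ≡ act not (𝓘 m j) (J ∷ʳ false)
act-insertion-word {m} j J = begin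
  act not (insertion-word j J) ∅                          ≡⟨ List.foldr-++ (move not) ∅ (𝓘 m j) _ ⟩
  act not (𝓘 m j) (act not (List.map inject₁ w[ J ]) ∅)   ≡⟨ cong (act not (𝓘 m j)) (begin
    act not (List.map inject₁ w[ J ]) ∅             ≡⟨ cong (act not (List.map inject₁ w[ J ])) (∅-∷ʳ m) ⟩
    act not (List.map inject₁ w[ J ]) (∅ ∷ʳ false)  ≡⟨ act-∷ʳ w[ J ] ∅ false ⟩
    act not w[ J ] ∅ ∷ʳ false                       ≡⟨ cong (_∷ʳ false) (act-w[] J) ⟩
    J ∷ʳ false                                      ∎) ⟩
  act not (𝓘 m j) (J ∷ʳ false)                            ∎
  where open ≡-Reasoning

-- Lying in a common coset gives equal sign vectors, namely K for w and an insertion into J for the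
-- other element.
iS⇒insertAt : {y : V m → V m} {w : V (suc m) → V (suc m)} (J : Subset m) (K : Subset (suc m)) →
              y ≗ ⟦ w[ J ] ⟧ → w ≗ ⟦ w[ K ] ⟧ → w ∈ iS y → ∃[ p ] ∃[ b ] K ≡ insertAt J p b
iS⇒insertAt {m} {y} {w} J K y≗ w≗ (j , j≤ , w∈ , _) with p , b , eq ← 𝓘⇒insertAt j j≤ J =
  p , b , trans (signs-injective (begin
    signs K                                 ≡⟨ 𝓜-signs K w≗ ⟨
    w (signs ∅)                             ≡⟨ coset-signs-∅ {w = ⟦ 𝓘 m j ⟧ ∘ extend y} w∈ ⟩
    ⟦ 𝓘 m j ⟧ (extend y (signs ∅))          ≡⟨ word-signs (insertion-word j J) (insertion-word-≗ j J y≗) ⟩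
    signs (act not (insertion-word j J) ∅)  ∎))
  (trans (act-insertion-word j J) eq)
  where open ≡-Reasoning

insertAt⇒iS : {y : V m → V m} (J : Subset m) → y ≗ ⟦ w[ J ] ⟧ →
              ∀ p b → ⟦ w[ insertAt J p b ] ⟧ ∈ iS y
insertAt⇒iS {m} {y} J y≗ p b with j , j≤ , eq ← insertAt⇒𝓘 p b J =
  j , j≤ , subst (λ K → MinRep (⟦ 𝓘 m j ⟧ ∘ extend y) ⟦ w[ K ] ⟧) (trans (act-insertion-word j J) eq)
    (minRep-𝓜 (insertion-word j J) (insertion-word-≗ j J y≗))

-- Disjointness and covering of the deletion spheres

corollary5p6 : (m : ℕ) (a : ℤ) → let n = suc m in IsPerfectCode (𝓜ₐ n a)
corollary5p6 m a = disjoint , (λ { (_ , _ , y∈𝓜 , _) → y∈𝓜 }) , covering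
  where
  -- The length of w is the weight of its sign vector, so the congruence on lengths becomes one on
  -- the offset of the insertion.
  codeword : {w : V (suc m) → V (suc m)} {y : V m → V m} (J : Subset m) → y ≗ ⟦ w[ J ] ⟧ →
             w ∈ 𝓜ₐ (suc m) a → w ∈ iS y →
             ∃[ p ] ∃[ b ] w ≗ ⟦ w[ insertAt J p b ] ⟧ × (+ (offset J p b + weight J)) ≡ a [mod suc (suc m) ]
  codeword J y≗ ((K , w≗) , k , w-length , k≡a) w∈iS with iS⇒insertAt J K y≗ w≗ w∈iS
  ... | p , b , refl = p , b , w≗ , subst (λ l → (+ l) ≡ a [mod suc (suc m) ])
    (trans (HasLength-unique w-length (length-𝓜 K w≗)) (weight-insertAt J p b)) k≡a

  disjoint : ∀ w w′ → w ∈ 𝓜ₐ (suc m) a → w′ ∈ 𝓜ₐ (suc m) a → ¬ (w ≗ w′) → Empty (dS w ∩ dS w′)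
  disjoint w w′ w∈ w′∈ w≢w′ y (((J , y≗) , w∈iS) , (_ , w′∈iS))
    with p , b , w≗ , ≡a ← codeword J y≗ w∈ w∈iS | q , c , w′≗ , ≡a′ ← codeword J y≗ w′∈ w′∈iS =
    w≢w′ λ v → trans (w≗ v) (trans (cong (λ K → ⟦ w[ K ] ⟧ v) same) (sym (w′≗ v)))
    where
    same : insertAt J p b ≡ insertAt J q c
    same = offset-injective J p q b c
      -- Offsets are at most m + 1, hence smaller than the modulus m + 2.
      (residue-unique a (weight J) (s≤s (offset≤ J p b)) (s≤s (offset≤ J q c)) ≡a ≡a′)

  covering : ∀ {y} → y ∈ 𝓜 m → ∃[ w ] w ∈ 𝓜ₐ (suc m) a × y ∈ dS w
  -- The required residue fixes an offset `d`, and some insertion into J realises it.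
  covering (J , y≗) with d , d<N , ≡a ← residue-exists a (weight J) (suc (suc m))
                   with p , b , refl ← offset-surjective J (s≤s⁻¹ d<N) =
    ⟦ w[ K ] ⟧ ,
    ((K , λ _ → refl) , weight K , length-𝓜 K (λ _ → refl) ,
      subst (λ l → (+ l) ≡ a [mod suc (suc m) ]) (sym (weight-insertAt J p b)) ≡a) ,
    (J , y≗) , insertAt⇒iS J y≗ p b
    where K = insertAt J p b
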